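{- Let $\mathbf{B}$ be a connected bidirected graph with $m$ vertices and $n$ arrows, and $q=q_{\mathbf{B}}$. For every $x\in\mathcal{R}^{\rm inc}_{\mathbf{B}}$ with $q(x)\ne0$, the reflection $\rho_x(y)=y-\frac{2q(y,x)}{q(x,x)}x$ restricts to an automorphism of $\mathbb{Z}^n$, and there is an orthogonal matrix $O^x\in\mathbb{M}_m(\mathbb{Z})$ such that $I(\mathbf{B})^T\rho_x=O^xI(\mathbf{B})^T$.
   Context: A bidirected graph $\mathbf{B}$: vertices $V(\mathbf{B})$ ($|V|=m$), arrows $E(\mathbf{B})=\{1,\dots,n\}$, each arrow $i$ with signed endpoints $\mathbbm{v}(i)=\{(u,\epsilon),(u',\epsilon')\}$; sign $\sigma(i)=-\epsilon\epsilon'$. $I(\mathbf{B})^Te_i=\epsilon e_u+\epsilon'e_{u'}$, $q_{\mathbf{B}}(x)=\frac12x^TI(\mathbf{B})I(\mathbf{B})^Tx$, $q(x,y)=q(x+y)-q(x)-q(y)$. Connected: underlying multigraph connected. Walks $(v_0,i_1,\dots,i_\ell,v_\ell)$ use arrows or formal inverses $i^{ -1}$ of directed loops (same endpoints and sign) joining consecutive vertices. With $d(v,i)=d$ if $(v,d)\in\mathbbm{v}(i)$ and $(v,-d)\notin\mathbbm{v}(i)$, $d(v,i)=1$ for a directed loop at $v$, $d(v,i^{ -1})=-1$, and $0$ otherwise, $\mathrm{inc}(\omega)=\sum_t\sigma(\omega^{[t-1]})d(v_{t-1},i_t)e_{i_t}$ ($\omega^{[t]}$ the initial subwalk of length $t$,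 $\sigma$ of a walk the product of signs, $e_{i^{ -1}}=e_i$), and $\mathcal{R}^{\rm inc}_{\mathbf{B}}=\{\pm\mathrm{inc}(\omega):\omega\text{ a walk}\}$. -}

module Defs where

open import Data.Nat using (ℕ; zero; suc)
open import Data.Fin using (Fin; zero; suc; _≟_)
open import Data.Integer as ℤ using (ℤ; +_)
open import Data.Rational as ℚ using (ℚ; ½; ≢-nonZero; _÷_)
open import Data.Sign using (Sign) renaming (_≟_ to _≟ˢ_; _*_ to _*ˢ_; opposite to opp)
open import Data.Product using (_×_; _,_; Σ; ∃; ∃-syntax; proj₁; proj₂)
open import Data.Sum using (_⊎_)
open import Relation.Nullary using (yes; no; ¬_)
open import Relation.Binary.PropositionalEquality using (_≡_; _≢_)
open import Relation.Binary.Construct.Closure.ReflexiveTransitive using (Star)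

------------------------------------------------------------------------
-- Bidirected graphs with vertex set Fin m and arrow set Fin n.
-- Each arrow i has two signed endpoints (u , ε) and (u' , ε'), stored as an
-- ordered pair; every notion below is symmetric in the two endpoints, so
-- this faithfully represents the unordered pair 𝕧(i).

SignedVertex : ℕ → Set
SignedVertex m = Fin m × Sign

record BidirectedGraph (m n : ℕ) : Set where
  field
    end₁ : Fin n → SignedVertex m
    end₂ : Fin n → SignedVertex m

module _ {m n : ℕ} (B : BidirectedGraph m n) where
  open BidirectedGraph B

  vtx₁ vtx₂ : Fin n → Fin m
  vtx₁ i = proj₁ (end₁ i)
  vtx₂ i = proj₁ (end₂ i)

  sg₁ sg₂ : Fin n → Sign
  sg₁ i = proj₂ (end₁ i)
  sg₂ i = proj₂ (end₂ i)

  -- σ(i) = - ε ε'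
  σ : Fin n → Sign
  σ i = opp (sg₁ i *ˢ sg₂ i)

  -- arrow i joins u and w (in the underlying multigraph)
  Joins : Fin n → Fin m → Fin m → Set
  Joins i u w = (vtx₁ i ≡ u × vtx₂ i ≡ w) ⊎ (vtx₁ i ≡ w × vtx₂ i ≡ u)

  -- connectedness of the underlying multigraph
  Adjacent : Fin m → Fin m → Set
  Adjacent u w = ∃[ i ] Joins i u w

  Connected : Set
  Connected = ∀ u w → Star Adjacent u w

  -- directed loop at v: 𝕧(i) = {(v , ε) , (v , -ε)}
  DirectedLoop : Fin n → Fin m → Set
  DirectedLoop i v = vtx₁ i ≡ v × vtx₂ i ≡ v × sg₂ i ≡ opp (sg₁ i)

  -- steps of a walk: an arrow joining consecutive vertices, or the formal
  -- inverse of a directed loop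
  data Step (u : Fin m) : Fin m → Set where
    arr : ∀ {w} (i : Fin n) → Joins i u w → Step u w
    inv : (i : Fin n) → DirectedLoop i u → Step u u

  data Walk : Fin m → Fin m → Set where
    [] : ∀ {v} → Walk v v
    _∷_ : ∀ {u w z} → Step u w → Walk w z → Walk u z

  stepArrow : ∀ {u w} → Step u w → Fin n
  stepArrow (arr i _) = i
  stepArrow (inv i _) = i

  -- σ(i⁻¹) = σ(i)
  stepSign : ∀ {u w} → Step u w → Sign
  stepSign s = σ (stepArrow s)

  signℤ : Sign → ℤ
  signℤ Sign.+ = + 1
  signℤ Sign.- = ℤ.-[1+ 0 ]

  -- d(v , i) for an arrow i:
  --   1 if i is a directed loop at v;
  --   d if (v , d) ∈ 𝕧(i) and (v , -d) ∉ 𝕧(i);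
  --   0 otherwise.
  dArrow : Fin m → Fin n → ℤ
  dArrow v i with vtx₁ i ≟ v | vtx₂ i ≟ v
  ... | yes _ | yes _ with sg₁ i ≟ˢ sg₂ i
  ...   | yes _ = signℤ (sg₁ i)
  ...   | no _  = + 1
  dArrow v i | yes _ | no _ = signℤ (sg₁ i)
  dArrow v i | no _  | yes _ = signℤ (sg₂ i)
  dArrow v i | no _  | no _ = + 0

  -- d(v , step): d(v , i⁻¹) = -1
  dStep : ∀ {u w} → Step u w → ℤ
  dStep {u} (arr i _) = dArrow u i
  dStep (inv i _) = ℤ.-[1+ 0 ]

  -- standard basis vector e_i of ℤⁿ
  e : Fin n → Fin n → ℤ
  e i j with i ≟ j
  ... | yes _ = + 1
  ... | no _  = + 0

  -- inc with accumulated sign s = σ(ω^[t-1]) of the walk traversed so far: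
  -- inc(ω) = Σ_t σ(ω^[t-1]) d(v_{t-1}, i_t) e_{i_t}
  incAcc : ∀ {u w} → Sign → Walk u w → Fin n → ℤ
  incAcc s [] j = + 0
  incAcc s (st ∷ ω) j =
    (signℤ s ℤ.* dStep st ℤ.* e (stepArrow st) j) ℤ.+ incAcc (s *ˢ stepSign st) ω j

  inc : ∀ {u w} → Walk u w → Fin n → ℤ
  inc = incAcc Sign.+

  -- x ∈ 𝓡^inc_B  (x = ± inc(ω) for some walk ω)
  InRinc : (Fin n → ℤ) → Set
  InRinc x = Σ (Fin m) λ u → Σ (Fin m) λ w → Σ (Walk u w) λ ω →
    (∀ j → x j ≡ inc ω j) ⊎ (∀ j → x j ≡ ℤ.- inc ω j)

------------------------------------------------------------------------
-- finite sums, matrices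

sumℤ : ∀ {k} → (Fin k → ℤ) → ℤ
sumℤ {zero} f = + 0
sumℤ {suc k} f = f zero ℤ.+ sumℤ (λ j → f (suc j))

sumℚ : ∀ {k} → (Fin k → ℚ) → ℚ
sumℚ {zero} f = ℚ.0ℚ
sumℚ {suc k} f = f zero ℚ.+ sumℚ (λ j → f (suc j))

toℚ : ℤ → ℚ
toℚ z = z ℚ./ 1

module _ {m n : ℕ} (B : BidirectedGraph m n) where
  open BidirectedGraph B

  -- the matrix I(B)ᵀ ∈ M_{m×n}(ℤ): column i is ε e_u + ε' e_u'
  IT : Fin m → Fin n → ℤ
  IT v i = ind (vtx₁ B i) (sg₁ B i) ℤ.+ ind (vtx₂ B i) (sg₂ B i)
    where
    ind : Fin m → Sign → ℤ
    ind u s with u ≟ v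
    ... | yes _ = signℤ B s
    ... | no _  = + 0

  -- I(B) ∈ M_{n×m}(ℤ)
  I : Fin n → Fin m → ℤ
  I i v = IT v i

  -- I(B)ᵀ x for x ∈ ℤⁿ
  ITmul : (Fin n → ℤ) → Fin m → ℤ
  ITmul x v = sumℤ λ i → IT v i ℤ.* x i

  -- q_B(x) = ½ xᵀ I(B) I(B)ᵀ x
  q : (Fin n → ℤ) → ℚ
  q x = ½ ℚ.* toℚ (sumℤ λ i → x i ℤ.* (sumℤ λ v → I i v ℤ.* ITmul x v))

  -- q(x , y) = q(x + y) - q(x) - q(y)
  qb : (Fin n → ℤ) → (Fin n → ℤ) → ℚ
  qb x y = q (λ i → x i ℤ.+ y i) ℚ.- q x ℚ.- q y

  -- the coefficient 2 q(y , x) / q(x , x)  (junk value 0 when q(x , x) = 0,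
  -- which is never used below)
  coef : (Fin n → ℤ) → (Fin n → ℤ) → ℚ
  coef x y with qb x x ℚ.≟ ℚ.0ℚ
  ... | yes _ = ℚ.0ℚ
  ... | no ne = _÷_ (toℚ (+ 2) ℚ.* qb y x) (qb x x) {{≢-nonZero ne}}

  -- ρ_x(y) = y - (2 q(y , x) / q(x , x)) x, for y ∈ ℤⁿ (valued in ℚⁿ)
  ρ : (Fin n → ℤ) → (Fin n → ℤ) → Fin n → ℚ
  ρ x y j = toℚ (y j) ℚ.- coef x y ℚ.* toℚ (x j)

-- orthogonal matrix in M_m(ℤ): Oᵀ O = identity
δ : ∀ {m} → Fin m → Fin m → ℤ
δ u v with u ≟ v
... | yes _ = + 1
... | no _  = + 0

Orthogonal : ∀ {m} → (Fin m → Fin m → ℤ) → Set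
Orthogonal {m} O = ∀ u v → sumℤ (λ w → O w u ℤ.* O w v) ≡ δ u v

module Submission where

-- A walk ω from u to w satisfies I(B)ᵀ inc(ω) = e_u − σ(ω) e_w, so for x ∈ 𝓡^inc the
-- vector a = I(B)ᵀ x is ±(e_u ± e_w) with u ≠ w, or ±2 e_u (the case a = 0 is excluded
-- by q(x) = ½ a·a ≠ 0).  In every case the coroot λ = 2a/(a·a) is integral.  Since
-- q(y,x) = (I(B)ᵀ y)·a, the reflection is ρ_x(y) = y − ((I(B)ᵀ y)·λ) x, an integral
-- involution, and I(B)ᵀ carries it to the reflection O = 1 − aλᵀ of ℤ^m, which is
-- integral and orthogonal.

open import Defs
open import Data.Nat using (ℕ; zero; suc)
open import Data.Fin using (Fin; zero; suc; _≟_)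
open import Data.Integer using (ℤ; +_; -[1+_]; _+_; _*_; -_; _-_; _◃_)
import Data.Integer.Properties as ℤ
open import Data.Integer.Tactic.RingSolver using (solve-∀)
open import Algebra.Properties.Semiring.Sum ℤ.+-*-semiring
  using (sum; ∑-distrib-+; ∑-comm; *-distribˡ-sum; *-distribʳ-sum; sum-replicate-zero)
open import Data.Rational using (ℚ; 0ℚ; ½; _÷_)
import Data.Rational as ℚ
import Data.Rational.Properties as ℚ
open import Data.Rational.Solver using (module +-*-Solver)
open import Data.Rational.Unnormalised as ℚᵘ using (mkℚᵘ; *≡*)
import Data.Rational.Unnormalised.Properties as ℚᵘ
open import Data.Sign as Sign using (Sign; opposite)
import Data.Sign.Properties as Sign
open import Data.Product using (_×_; Σ; _,_)
open import Data.Sum using (inj₁; inj₂; reduce)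
open import Data.Empty using (⊥-elim)
open import Function using (_∘_)
open import Relation.Nullary using (yes; no)
open import Relation.Binary.PropositionalEquality

-- Signs

sgn : Sign → ℤ
sgn s = s ◃ 1

sgn-* : ∀ s t → sgn (s Sign.* t) ≡ sgn s * sgn t
sgn-* s t = ℤ.◃-distrib-* s t 1 1

≢⇒≡opposite : ∀ {s t} → s ≢ t → t ≡ opposite s
≢⇒≡opposite {Sign.+} {Sign.+} s≢t = ⊥-elim (s≢t refl)
≢⇒≡opposite {Sign.+} {Sign.-} _ = refl
≢⇒≡opposite {Sign.-} {Sign.+} _ = refl
≢⇒≡opposite {Sign.-} {Sign.-} s≢t = ⊥-elim (s≢t refl)

-- A step along arrow i from u to w has d(u,i) · (column i of I(B)ᵀ) = e_u − σ(i) e_w; these are the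
-- underlying sign identities for a link, an undirected loop and a directed loop.

sgn-cancel-link : ∀ s t a b → sgn s * (sgn s * a + sgn t * b) ≡ a - sgn (opposite (s Sign.* t)) * b
sgn-cancel-link Sign.+ Sign.+ = solve-∀
sgn-cancel-link Sign.+ Sign.- = solve-∀
sgn-cancel-link Sign.- Sign.+ = solve-∀
sgn-cancel-link Sign.- Sign.- = solve-∀

sgn-cancel-loop : ∀ {s t} → s ≡ t → ∀ a →
  sgn s * (sgn s * a + sgn t * a) ≡ a - sgn (opposite (s Sign.* t)) * a
sgn-cancel-loop {Sign.+} refl = solve-∀
sgn-cancel-loop {Sign.-} refl = solve-∀

sgn-cancel-directed-loop : ∀ {s t} → t ≡ opposite s → ∀ k a →
  k * (sgn s * a + sgn t * a) ≡ a - sgn (opposite (s Sign.* t)) * a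
sgn-cancel-directed-loop {Sign.+} refl = solve-∀
sgn-cancel-directed-loop {Sign.-} refl = solve-∀

-- Finite sums and the dot product on ℤ^k

sumℤ≡sum : ∀ {k} (f : Fin k → ℤ) → sumℤ f ≡ sum f
sumℤ≡sum {zero} f = refl
sumℤ≡sum {suc k} f = cong (_+_ (f zero)) (sumℤ≡sum (f ∘ suc))

sumℤ-cong : ∀ {k} {f g : Fin k → ℤ} → (∀ j → f j ≡ g j) → sumℤ f ≡ sumℤ g
sumℤ-cong {zero} f≗g = refl
sumℤ-cong {suc k} f≗g = cong₂ _+_ (f≗g zero) (sumℤ-cong (f≗g ∘ suc))

sumℤ-zero : ∀ k → sumℤ {k} (λ _ → + 0) ≡ + 0
sumℤ-zero k = trans (sumℤ≡sum {k} (λ _ → + 0)) (sum-replicate-zero k)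

sumℤ-+ : ∀ {k} (f g : Fin k → ℤ) → sumℤ (λ j → f j + g j) ≡ sumℤ f + sumℤ g
sumℤ-+ f g = trans (sumℤ≡sum (λ j → f j + g j))
  (trans (∑-distrib-+ f g) (sym (cong₂ _+_ (sumℤ≡sum f) (sumℤ≡sum g))))

sumℤ-*ˡ : ∀ {k} c (f : Fin k → ℤ) → sumℤ (λ j → c * f j) ≡ c * sumℤ f
sumℤ-*ˡ c f = trans (sumℤ≡sum (λ j → c * f j))
  (trans (sym (*-distribˡ-sum c f)) (cong (c *_) (sym (sumℤ≡sum f))))

sumℤ-*ʳ : ∀ {k} c (f : Fin k → ℤ) → sumℤ (λ j → f j * c) ≡ sumℤ f * c
sumℤ-*ʳ c f = trans (sumℤ≡sum (λ j → f j * c))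
  (trans (sym (*-distribʳ-sum c f)) (cong (_* c) (sym (sumℤ≡sum f))))

sumℤ-comm : ∀ {k l} (f : Fin k → Fin l → ℤ) →
  sumℤ (λ i → sumℤ (f i)) ≡ sumℤ (λ j → sumℤ (λ i → f i j))
sumℤ-comm f = begin
  sumℤ (λ i → sumℤ (f i))              ≡⟨ sumℤ-cong (λ i → sumℤ≡sum (f i)) ⟩
  sumℤ (λ i → sum (f i))               ≡⟨ sumℤ≡sum (λ i → sum (f i)) ⟩
  sum (λ i → sum (f i))                ≡⟨ ∑-comm f ⟩
  sum (λ j → sum (λ i → f i j))        ≡⟨ sumℤ≡sum (λ j → sum (λ i → f i j)) ⟨
  sumℤ (λ j → sum (λ i → f i j))       ≡⟨ sumℤ-cong (λ j → sumℤ≡sum (λ i → f i j)) ⟨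
  sumℤ (λ j → sumℤ (λ i → f i j))      ∎
  where open ≡-Reasoning

δ-refl : ∀ {k} (u : Fin k) → δ u u ≡ + 1
δ-refl u with u ≟ u
... | yes _ = refl
... | no u≢u = ⊥-elim (u≢u refl)

δ-≢ : ∀ {k} {u v : Fin k} → u ≢ v → δ u v ≡ + 0
δ-≢ {u = u} {v} u≢v with u ≟ v
... | yes u≡v = ⊥-elim (u≢v u≡v)
... | no _ = refl

δ-sym : ∀ {k} (u v : Fin k) → δ u v ≡ δ v u
δ-sym u v with u ≟ v | v ≟ u
... | yes _ | yes _ = refl
... | no _ | no _ = refl
... | yes u≡v | no v≢u = ⊥-elim (v≢u (sym u≡v))
... | no u≢v | yes v≡u = ⊥-elim (u≢v (sym v≡u))

δ-suc : ∀ {k} (u v : Fin k) → δ (suc u) (suc v) ≡ δ u v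
δ-suc u v with u ≟ v
... | yes _ = refl
... | no _ = refl

infix 7 _·_

_·_ : ∀ {k} → (Fin k → ℤ) → (Fin k → ℤ) → ℤ
a · b = sumℤ λ w → a w * b w

·-cong : ∀ {k} {a a′ b b′ : Fin k → ℤ} →
  (∀ w → a w ≡ a′ w) → (∀ w → b w ≡ b′ w) → a · b ≡ a′ · b′
·-cong a≗a′ b≗b′ = sumℤ-cong λ w → cong₂ _*_ (a≗a′ w) (b≗b′ w)

·-congʳ : ∀ {k} (a : Fin k → ℤ) {b b′ : Fin k → ℤ} → (∀ w → b w ≡ b′ w) → a · b ≡ a · b′
·-congʳ a b≗b′ = ·-cong {a = a} (λ _ → refl) b≗b′

·-comm : ∀ {k} (a b : Fin k → ℤ) → a · b ≡ b · a
·-comm a b = sumℤ-cong λ w → ℤ.*-comm (a w) (b w)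

·-zeroʳ : ∀ {k} (a : Fin k → ℤ) → a · (λ _ → + 0) ≡ + 0
·-zeroʳ {k} a = trans (sumℤ-cong λ w → ℤ.*-zeroʳ (a w)) (sumℤ-zero k)

·-distribʳ-+ : ∀ {k} (a b c : Fin k → ℤ) → a · (λ w → b w + c w) ≡ a · b + a · c
·-distribʳ-+ a b c =
  trans (sumℤ-cong λ w → ℤ.*-distribˡ-+ (a w) (b w) (c w)) (sumℤ-+ (λ w → a w * b w) (λ w → a w * c w))

·-distribˡ-+ : ∀ {k} (a b c : Fin k → ℤ) → (λ w → a w + b w) · c ≡ a · c + b · c
·-distribˡ-+ a b c = begin
  (λ w → a w + b w) · c    ≡⟨ ·-comm _ c ⟩
  c · (λ w → a w + b w)    ≡⟨ ·-distribʳ-+ c a b ⟩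
  c · a + c · b            ≡⟨ cong₂ _+_ (·-comm c a) (·-comm c b) ⟩
  a · c + b · c            ∎
  where open ≡-Reasoning

·-square-+ : ∀ {k} (a b : Fin k → ℤ) →
  (λ w → a w + b w) · (λ w → a w + b w) ≡ a · a + + 2 * (a · b) + b · b
·-square-+ a b = begin
  (λ w → a w + b w) · (λ w → a w + b w)   ≡⟨ ·-distribʳ-+ (λ w → a w + b w) a b ⟩
  (λ w → a w + b w) · a + (λ w → a w + b w) · b
                                          ≡⟨ cong₂ _+_ (·-distribˡ-+ a b a) (·-distribˡ-+ a b b) ⟩
  (a · a + b · a) + (a · b + b · b)       ≡⟨ cong (λ t → (a · a + t) + (a · b + b · b)) (·-comm b a) ⟩
  (a · a + a · b) + (a · b + b · b)       ≡⟨ collect (a · a) (a · b) (b · b) ⟩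
  a · a + + 2 * (a · b) + b · b           ∎
  where
  open ≡-Reasoning
  collect : ∀ p r t → (p + r) + (r + t) ≡ p + + 2 * r + t
  collect = solve-∀

·-*ʳ : ∀ {k} (a : Fin k → ℤ) c (b : Fin k → ℤ) → a · (λ w → c * b w) ≡ c * (a · b)
·-*ʳ a c b = trans (sumℤ-cong λ w → swap (a w) c (b w)) (sumℤ-*ˡ c (λ w → a w * b w))
  where
  swap : ∀ x y z → x * (y * z) ≡ y * (x * z)
  swap = solve-∀

·-negʳ : ∀ {k} (a b : Fin k → ℤ) → a · (λ w → - b w) ≡ - (a · b)
·-negʳ a b = begin
  a · (λ w → - b w)         ≡⟨ ·-congʳ a (λ w → sym (ℤ.-1*i≡-i (b w))) ⟩
  a · (λ w → -[1+ 0 ] * b w) ≡⟨ ·-*ʳ a -[1+ 0 ] b ⟩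
  -[1+ 0 ] * (a · b)        ≡⟨ ℤ.-1*i≡-i (a · b) ⟩
  - (a · b)                 ∎
  where open ≡-Reasoning

·-linearʳ : ∀ {k} (a b : Fin k → ℤ) c (d : Fin k → ℤ) →
  a · (λ w → b w - c * d w) ≡ a · b - c * (a · d)
·-linearʳ a b c d =
  trans (·-distribʳ-+ a b _) (cong (_+_ (a · b)) (trans (·-negʳ a _) (cong -_ (·-*ʳ a c d))))

·-linearˡ : ∀ {k} (b : Fin k → ℤ) c (d a : Fin k → ℤ) →
  (λ w → b w - c * d w) · a ≡ b · a - c * (d · a)
·-linearˡ b c d a = begin
  (λ w → b w - c * d w) · a ≡⟨ ·-comm _ a ⟩
  a · (λ w → b w - c * d w) ≡⟨ ·-linearʳ a b c d ⟩
  a · b - c * (a · d)       ≡⟨ cong₂ (λ p r → p - c * r) (·-comm a b) (·-comm a d) ⟩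
  b · a - c * (d · a)       ∎
  where open ≡-Reasoning

δ·≡ : ∀ {k} (u : Fin k) (b : Fin k → ℤ) → δ u · b ≡ b u
δ·≡ {suc k} zero b = trans (cong₂ _+_ (ℤ.*-identityˡ (b zero)) (sumℤ-zero k)) (ℤ.+-identityʳ (b zero))
δ·≡ (suc u) b = begin
  + 0 + δ (suc u) ∘ suc · b ∘ suc  ≡⟨ ℤ.+-identityˡ _ ⟩
  δ (suc u) ∘ suc · b ∘ suc        ≡⟨ sumℤ-cong (λ w → cong (_* b (suc w)) (δ-suc u w)) ⟩
  δ u · b ∘ suc                    ≡⟨ δ·≡ u (b ∘ suc) ⟩
  b (suc u)                        ∎
  where open ≡-Reasoning

·δ≡ : ∀ {k} (b : Fin k → ℤ) (u : Fin k) → b · δ u ≡ b u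
·δ≡ b u = trans (·-comm b (δ u)) (δ·≡ u b)

·-adjoint : ∀ {m n} (M : Fin m → Fin n → ℤ) (y : Fin n → ℤ) (b : Fin m → ℤ) →
  y · (λ i → (λ v → M v i) · b) ≡ (λ v → M v · y) · b
·-adjoint M y b = begin
  sumℤ (λ i → y i * sumℤ (λ v → M v i * b v))
    ≡⟨ sumℤ-cong (λ i → sumℤ-*ˡ (y i) (λ v → M v i * b v)) ⟨
  sumℤ (λ i → sumℤ (λ v → y i * (M v i * b v)))
    ≡⟨ sumℤ-comm (λ i v → y i * (M v i * b v)) ⟩
  sumℤ (λ v → sumℤ (λ i → y i * (M v i * b v)))
    ≡⟨ sumℤ-cong (λ v → trans (sumℤ-cong (λ i → regroup (y i) (M v i) (b v))) (sumℤ-*ʳ (b v) (λ i → M v i * y i))) ⟩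
  sumℤ (λ v → sumℤ (λ i → M v i * y i) * b v)
    ∎
  where
  open ≡-Reasoning
  regroup : ∀ p r s → p * (r * s) ≡ (r * p) * s
  regroup = solve-∀

-- The embedding ℤ → ℚ

toℚᵘ-toℚ : ∀ z → ℚ.toℚᵘ (toℚ z) ℚᵘ.≃ mkℚᵘ z 0
toℚᵘ-toℚ z = ℚ.toℚᵘ-fromℚᵘ (mkℚᵘ z 0)

toℚ-+ : ∀ a b → toℚ (a + b) ≡ toℚ a ℚ.+ toℚ b
toℚ-+ a b = ℚ.toℚᵘ-injective (begin
  ℚ.toℚᵘ (toℚ (a + b))                   ≈⟨ toℚᵘ-toℚ (a + b) ⟩
  mkℚᵘ (a + b) 0                         ≈⟨ *≡* (unit-denominators a b) ⟩
  mkℚᵘ a 0 ℚᵘ.+ mkℚᵘ b 0                 ≈⟨ ℚᵘ.+-cong (toℚᵘ-toℚ a) (toℚᵘ-toℚ b) ⟨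
  ℚ.toℚᵘ (toℚ a) ℚᵘ.+ ℚ.toℚᵘ (toℚ b)     ≈⟨ ℚ.toℚᵘ-homo-+ (toℚ a) (toℚ b) ⟨
  ℚ.toℚᵘ (toℚ a ℚ.+ toℚ b)               ∎)
  where
  open ℚᵘ.≃-Reasoning
  unit-denominators : ∀ a b → (a + b) * + 1 ≡ (a * + 1 + b * + 1) * + 1
  unit-denominators = solve-∀

toℚ-* : ∀ a b → toℚ (a * b) ≡ toℚ a ℚ.* toℚ b
toℚ-* a b = ℚ.toℚᵘ-injective (begin
  ℚ.toℚᵘ (toℚ (a * b))                   ≈⟨ toℚᵘ-toℚ (a * b) ⟩
  mkℚᵘ (a * b) 0                         ≈⟨ ℚᵘ.≃-refl ⟩
  mkℚᵘ a 0 ℚᵘ.* mkℚᵘ b 0                 ≈⟨ ℚᵘ.*-cong (toℚᵘ-toℚ a) (toℚᵘ-toℚ b) ⟨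
  ℚ.toℚᵘ (toℚ a) ℚᵘ.* ℚ.toℚᵘ (toℚ b)     ≈⟨ ℚ.toℚᵘ-homo-* (toℚ a) (toℚ b) ⟨
  ℚ.toℚᵘ (toℚ a ℚ.* toℚ b)               ∎)
  where open ℚᵘ.≃-Reasoning

toℚ-neg : ∀ a → toℚ (- a) ≡ ℚ.- toℚ a
toℚ-neg a = ℚ.toℚᵘ-injective (begin
  ℚ.toℚᵘ (toℚ (- a))                     ≈⟨ toℚᵘ-toℚ (- a) ⟩
  ℚᵘ.- mkℚᵘ a 0                          ≈⟨ ℚᵘ.-‿cong (toℚᵘ-toℚ a) ⟨
  ℚᵘ.- ℚ.toℚᵘ (toℚ a)                    ≈⟨ ℚ.toℚᵘ-homo‿- (toℚ a) ⟨
  ℚ.toℚᵘ (ℚ.- toℚ a)                     ∎)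
  where open ℚᵘ.≃-Reasoning

toℚ-- : ∀ a b → toℚ (a - b) ≡ toℚ a ℚ.- toℚ b
toℚ-- a b = trans (toℚ-+ a (- b)) (cong (toℚ a ℚ.+_) (toℚ-neg b))

sumℚ-toℚ : ∀ {k} {f : Fin k → ℚ} (g : Fin k → ℤ) → (∀ j → f j ≡ toℚ (g j)) → sumℚ f ≡ toℚ (sumℤ g)
sumℚ-toℚ {zero} g f≗g = refl
sumℚ-toℚ {suc k} g f≗g = trans (cong₂ ℚ._+_ (f≗g zero) (sumℚ-toℚ (g ∘ suc) (f≗g ∘ suc)))
  (sym (toℚ-+ (g zero) (sumℤ (g ∘ suc))))

p≡r*q⇒p÷q≡r : ∀ p q r .{{_ : ℚ.NonZero q}} → p ≡ r ℚ.* q → p ÷ q ≡ r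
p≡r*q⇒p÷q≡r p q r p≡r*q = begin
  p ℚ.* ℚ.1/ q               ≡⟨ cong (ℚ._* ℚ.1/ q) p≡r*q ⟩
  (r ℚ.* q) ℚ.* ℚ.1/ q       ≡⟨ ℚ.*-assoc r q (ℚ.1/ q) ⟩
  r ℚ.* (q ℚ.* ℚ.1/ q)       ≡⟨ cong (r ℚ.*_) (ℚ.*-inverseʳ q) ⟩
  r ℚ.* ℚ.1ℚ                 ≡⟨ ℚ.*-identityʳ r ⟩
  r                          ∎
  where open ≡-Reasoning

-- The coroot of a ∈ ℤ^m is λ = 2a/(a·a).  It is integral exactly when a = g λ with
-- g (λ·λ) = 2, and then the reflection in a has integer entries.
record IntegralCoroot {m} (a : Fin m → ℤ) : Set where
  field
    coroot : Fin m → ℤ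
    scale : ℤ
    root≡scale*coroot : ∀ v → a v ≡ scale * coroot v
    scale*coroot·coroot≡2 : scale * (coroot · coroot) ≡ + 2

module _ {m} {a : Fin m → ℤ} (κ : IntegralCoroot a) where
  open IntegralCoroot κ

  ·root≡scale*·coroot : ∀ b → b · a ≡ scale * (b · coroot)
  ·root≡scale*·coroot b = trans (·-congʳ b root≡scale*coroot) (·-*ʳ b scale coroot)

  root·coroot≡2 : a · coroot ≡ + 2
  root·coroot≡2 = begin
    a · coroot                  ≡⟨ ·-comm a coroot ⟩
    coroot · a                  ≡⟨ ·root≡scale*·coroot coroot ⟩
    scale * (coroot · coroot)   ≡⟨ scale*coroot·coroot≡2 ⟩
    + 2                         ∎
    where open ≡-Reasoning

  root·root≡scale*2 : a · a ≡ scale * + 2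
  root·root≡scale*2 = trans (·root≡scale*·coroot a) (cong (scale *_) root·coroot≡2)

  reflect : (Fin m → ℤ) → Fin m → ℤ
  reflect b v = b v - (b · coroot) * a v

  reflect·coroot : ∀ b → reflect b · coroot ≡ - (b · coroot)
  reflect·coroot b = begin
    reflect b · coroot            ≡⟨ ·-linearˡ b β a coroot ⟩
    β - β * (a · coroot)          ≡⟨ cong (λ t → β - β * t) root·coroot≡2 ⟩
    β - β * + 2                   ≡⟨ twice-less β ⟩
    - β                           ∎
    where
    open ≡-Reasoning
    β : ℤ
    β = b · coroot
    twice-less : ∀ t → t - t * + 2 ≡ - t
    twice-less = solve-∀

  reflect-isometry : ∀ b c → reflect b · reflect c ≡ b · c
  reflect-isometry b c = begin
    reflect b · reflect c
      ≡⟨ ·-linearˡ b β a (reflect c) ⟩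
    b · reflect c - β * (a · reflect c)
      ≡⟨ cong₂ (λ p r → p - β * r) (·-linearʳ b c γ a) (·-linearʳ a c γ a) ⟩
    (b · c - γ * (b · a)) - β * (a · c - γ * (a · a))
      ≡⟨ cong₂ (λ p r → (b · c - γ * p) - β * (r - γ * (a · a)))
           (·root≡scale*·coroot b) (trans (·-comm a c) (·root≡scale*·coroot c)) ⟩
    (b · c - γ * (scale * β)) - β * (scale * γ - γ * (a · a))
      ≡⟨ cong (λ t → (b · c - γ * (scale * β)) - β * (scale * γ - γ * t)) root·root≡scale*2 ⟩
    (b · c - γ * (scale * β)) - β * (scale * γ - γ * (scale * + 2))
      ≡⟨ cancel (b · c) β γ scale ⟩
    b · c ∎
    where
    open ≡-Reasoning
    β γ : ℤ
    β = b · coroot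
    γ = c · coroot
    cancel : ∀ d β γ g → (d - γ * (g * β)) - β * (g * γ - γ * (g * + 2)) ≡ d
    cancel = solve-∀

  reflection : Fin m → Fin m → ℤ
  reflection v w = δ v w - a v * coroot w

  reflection·≡reflect : ∀ b v → reflection v · b ≡ reflect b v
  reflection·≡reflect b v = begin
    reflection v · b                    ≡⟨ ·-linearˡ (δ v) (a v) coroot b ⟩
    δ v · b - a v * (coroot · b)        ≡⟨ cong₂ (λ p r → p - a v * r) (δ·≡ v b) (·-comm coroot b) ⟩
    b v - a v * (b · coroot)            ≡⟨ cong (_-_ (b v)) (ℤ.*-comm (a v) (b · coroot)) ⟩
    b v - (b · coroot) * a v            ∎
    where open ≡-Reasoning

  reflection-orthogonal : Orthogonal reflection
  reflection-orthogonal u v = begin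
    column u · column v                 ≡⟨ ·-cong (column≡reflect u) (column≡reflect v) ⟩
    reflect (δ u) · reflect (δ v)       ≡⟨ reflect-isometry (δ u) (δ v) ⟩
    δ u · δ v                           ≡⟨ δ·≡ u (δ v) ⟩
    δ v u                               ≡⟨ δ-sym v u ⟩
    δ u v                               ∎
    where
    open ≡-Reasoning
    column : Fin m → Fin m → ℤ
    column u w = reflection w u
    column≡reflect : ∀ u w → column u w ≡ reflect (δ u) w
    column≡reflect u w = cong₂ _-_ (δ-sym w u)
      (trans (ℤ.*-comm (a w) (coroot u)) (cong (_* a w) (sym (δ·≡ u coroot))))

self-coroot : ∀ {m} {a : Fin m → ℤ} → a · a ≡ + 2 → IntegralCoroot a
self-coroot {a = a} a·a≡2 = record
  { coroot = a
  ; scale = + 1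
  ; root≡scale*coroot = λ v → sym (ℤ.*-identityˡ (a v))
  ; scale*coroot·coroot≡2 = trans (ℤ.*-identityˡ (a · a)) a·a≡2
  }

twice-unit-coroot : ∀ {m} {a : Fin m → ℤ} c u → (∀ v → a v ≡ + 2 * (sgn c * δ u v)) → IntegralCoroot a
twice-unit-coroot {m} c u a≗ = record
  { coroot = eᵤ
  ; scale = + 2
  ; root≡scale*coroot = a≗
  ; scale*coroot·coroot≡2 = cong (+ 2 *_) (begin
      eᵤ · eᵤ                        ≡⟨ ·-*ʳ eᵤ (sgn c) (δ u) ⟩
      sgn c * (eᵤ · δ u)             ≡⟨ cong (sgn c *_) (·δ≡ eᵤ u) ⟩
      sgn c * (sgn c * δ u u)        ≡⟨ cong (λ d → sgn c * (sgn c * d)) (δ-refl u) ⟩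
      sgn c * (sgn c * + 1)          ≡⟨ square c ⟩
      + 1                            ∎)
  }
  where
  open ≡-Reasoning
  eᵤ : Fin m → ℤ
  eᵤ v = sgn c * δ u v
  square : ∀ s → sgn s * (sgn s * + 1) ≡ + 1
  square Sign.+ = refl
  square Sign.- = refl

signed-difference·itself : ∀ {m} {a : Fin m → ℤ} c {u w : Fin m} t → u ≢ w →
  (∀ v → a v ≡ sgn c * (δ u v - sgn t * δ w v)) → a · a ≡ + 2
signed-difference·itself {a = a} c {u} {w} t u≢w a≗ = begin
  a · a                                          ≡⟨ ·-congʳ a a≗ ⟩
  a · (λ v → sgn c * (δ u v - sgn t * δ w v))    ≡⟨ ·-*ʳ a (sgn c) (λ v → δ u v - sgn t * δ w v) ⟩
  sgn c * (a · (λ v → δ u v - sgn t * δ w v))    ≡⟨ cong (sgn c *_) (·-linearʳ a (δ u) (sgn t) (δ w)) ⟩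
  sgn c * (a · δ u - sgn t * (a · δ w))          ≡⟨ cong₂ (λ p r → sgn c * (p - sgn t * r)) (·δ≡ a u) (·δ≡ a w) ⟩
  sgn c * (a u - sgn t * a w)                    ≡⟨ cong₂ (λ p r → sgn c * (p - sgn t * r)) au aw ⟩
  sgn c * (sgn c * (+ 1 - sgn t * + 0) - sgn t * (sgn c * (+ 0 - sgn t * + 1)))
                                                 ≡⟨ two c t ⟩
  + 2                                            ∎
  where
  open ≡-Reasoning
  au : a u ≡ sgn c * (+ 1 - sgn t * + 0)
  au = trans (a≗ u) (cong₂ (λ p r → sgn c * (p - sgn t * r)) (δ-refl u) (δ-≢ (u≢w ∘ sym)))
  aw : a w ≡ sgn c * (+ 0 - sgn t * + 1)
  aw = trans (a≗ w) (cong₂ (λ p r → sgn c * (p - sgn t * r)) (δ-≢ u≢w) (δ-refl w))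
  two : ∀ c t → sgn c * (sgn c * (+ 1 - sgn t * + 0) - sgn t * (sgn c * (+ 0 - sgn t * + 1))) ≡ + 2
  two Sign.+ Sign.+ = refl
  two Sign.+ Sign.- = refl
  two Sign.- Sign.+ = refl
  two Sign.- Sign.- = refl

signed-difference-coroot : ∀ {m} {a : Fin m → ℤ} c {u w : Fin m} t →
  (∀ v → a v ≡ sgn c * (δ u v - sgn t * δ w v)) → a · a ≢ + 0 → IntegralCoroot a
signed-difference-coroot {a = a} c {u} {w} t a≗ a·a≢0 with u ≟ w
... | no u≢w = self-coroot (signed-difference·itself c t u≢w a≗)
... | yes refl with t
...   | Sign.+ = ⊥-elim (a·a≢0 (trans (·-congʳ a a≡0) (·-zeroʳ a)))
  where
  cancels : ∀ k d → k * (d - + 1 * d) ≡ + 0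
  cancels = solve-∀
  a≡0 : ∀ v → a v ≡ + 0
  a≡0 v = trans (a≗ v) (cancels (sgn c) (δ u v))
...   | Sign.- = twice-unit-coroot c u (λ v → trans (a≗ v) (doubles (sgn c) (δ u v)))
  where
  doubles : ∀ k d → k * (d - -[1+ 0 ] * d) ≡ + 2 * (k * d)
  doubles = solve-∀

-- Incidence vectors of walks and the quadratic form

module _ {m n} (B : BidirectedGraph m n) where

  signℤ≡sgn : ∀ s → signℤ B s ≡ sgn s
  signℤ≡sgn Sign.+ = refl
  signℤ≡sgn Sign.- = refl

  signℤ≡sgn*1 : ∀ s → signℤ B s ≡ sgn s * + 1
  signℤ≡sgn*1 s = trans (signℤ≡sgn s) (sym (ℤ.*-identityʳ (sgn s)))

  e≡δ : ∀ i j → e B i j ≡ δ i j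
  e≡δ i j with i ≟ j
  ... | yes _ = refl
  ... | no _ = refl

  IT-column : ∀ v i → IT B v i ≡ sgn (sg₁ B i) * δ (vtx₁ B i) v + sgn (sg₂ B i) * δ (vtx₂ B i) v
  IT-column v i with vtx₁ B i ≟ v | vtx₂ B i ≟ v
  ... | yes _ | yes _ = cong₂ _+_ (signℤ≡sgn*1 (sg₁ B i)) (signℤ≡sgn*1 (sg₂ B i))
  ... | yes _ | no _ = cong₂ _+_ (signℤ≡sgn*1 (sg₁ B i)) (sym (ℤ.*-zeroʳ (sgn (sg₂ B i))))
  ... | no _ | yes _ = cong₂ _+_ (sym (ℤ.*-zeroʳ (sgn (sg₁ B i)))) (signℤ≡sgn*1 (sg₂ B i))
  ... | no _ | no _ = cong₂ _+_ (sym (ℤ.*-zeroʳ (sgn (sg₁ B i)))) (sym (ℤ.*-zeroʳ (sgn (sg₂ B i))))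

  dArrow-link₁ : ∀ {i} → vtx₁ B i ≢ vtx₂ B i → dArrow B (vtx₁ B i) i ≡ sgn (sg₁ B i)
  dArrow-link₁ {i} u₁≢u₂ with vtx₁ B i ≟ vtx₁ B i | vtx₂ B i ≟ vtx₁ B i
  ... | yes _ | no _ = signℤ≡sgn (sg₁ B i)
  ... | _ | yes u₂≡u₁ = ⊥-elim (u₁≢u₂ (sym u₂≡u₁))
  ... | no u₁≢u₁ | no _ = ⊥-elim (u₁≢u₁ refl)

  dArrow-link₂ : ∀ {i} → vtx₁ B i ≢ vtx₂ B i → dArrow B (vtx₂ B i) i ≡ sgn (sg₂ B i)
  dArrow-link₂ {i} u₁≢u₂ with vtx₁ B i ≟ vtx₂ B i | vtx₂ B i ≟ vtx₂ B i
  ... | no _ | yes _ = signℤ≡sgn (sg₂ B i)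
  ... | yes u₁≡u₂ | _ = ⊥-elim (u₁≢u₂ u₁≡u₂)
  ... | no _ | no u₂≢u₂ = ⊥-elim (u₂≢u₂ refl)

  dArrow-loop : ∀ {i v} → vtx₁ B i ≡ v → vtx₂ B i ≡ v → sg₁ B i ≡ sg₂ B i →
    dArrow B v i ≡ sgn (sg₁ B i)
  dArrow-loop {i} {v} u₁≡v u₂≡v s₁≡s₂ with vtx₁ B i ≟ v | vtx₂ B i ≟ v
  ... | yes _ | yes _ with sg₁ B i Sign.≟ sg₂ B i
  ...   | yes _ = signℤ≡sgn (sg₁ B i)
  ...   | no s₁≢s₂ = ⊥-elim (s₁≢s₂ s₁≡s₂)
  dArrow-loop u₁≡v u₂≡v s₁≡s₂ | no u₁≢v | _ = ⊥-elim (u₁≢v u₁≡v)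
  dArrow-loop u₁≡v u₂≡v s₁≡s₂ | yes _ | no u₂≢v = ⊥-elim (u₂≢v u₂≡v)

  dArrow-directed-loop : ∀ {i v} → DirectedLoop B i v → dArrow B v i ≡ + 1
  dArrow-directed-loop {i} {v} (u₁≡v , u₂≡v , s₂≡-s₁) with vtx₁ B i ≟ v | vtx₂ B i ≟ v
  ... | yes _ | yes _ with sg₁ B i Sign.≟ sg₂ B i
  ...   | yes s₁≡s₂ = ⊥-elim (Sign.s≢opposite[s] (sg₁ B i) (trans s₁≡s₂ s₂≡-s₁))
  ...   | no _ = refl
  dArrow-directed-loop (u₁≡v , u₂≡v , _) | no u₁≢v | _ = ⊥-elim (u₁≢v u₁≡v)
  dArrow-directed-loop (u₁≡v , u₂≡v , _) | yes _ | no u₂≢v = ⊥-elim (u₂≢v u₂≡v)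

  loop-column : ∀ {i v} w → vtx₁ B i ≡ v → vtx₂ B i ≡ v →
    IT B w i ≡ sgn (sg₁ B i) * δ v w + sgn (sg₂ B i) * δ v w
  loop-column {i} w u₁≡v u₂≡v = trans (IT-column w i)
    (cong₂ (λ p r → sgn (sg₁ B i) * δ p w + sgn (sg₂ B i) * δ r w) u₁≡v u₂≡v)

  link-step₁ : ∀ {i} v → vtx₁ B i ≢ vtx₂ B i →
    dArrow B (vtx₁ B i) i * IT B v i ≡ δ (vtx₁ B i) v - sgn (σ B i) * δ (vtx₂ B i) v
  link-step₁ {i} v u₁≢u₂ = trans (cong₂ _*_ (dArrow-link₁ u₁≢u₂) (IT-column v i))
    (sgn-cancel-link (sg₁ B i) (sg₂ B i) (δ (vtx₁ B i) v) (δ (vtx₂ B i) v))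

  link-step₂ : ∀ {i} v → vtx₁ B i ≢ vtx₂ B i →
    dArrow B (vtx₂ B i) i * IT B v i ≡ δ (vtx₂ B i) v - sgn (σ B i) * δ (vtx₁ B i) v
  link-step₂ {i} v u₁≢u₂ = begin
    dArrow B (vtx₂ B i) i * IT B v i
      ≡⟨ cong₂ _*_ (dArrow-link₂ u₁≢u₂) (trans (IT-column v i) (ℤ.+-comm (sgn s₁ * δ₁) (sgn s₂ * δ₂))) ⟩
    sgn s₂ * (sgn s₂ * δ₂ + sgn s₁ * δ₁)
      ≡⟨ sgn-cancel-link s₂ s₁ δ₂ δ₁ ⟩
    δ₂ - sgn (opposite (s₂ Sign.* s₁)) * δ₁
      ≡⟨ cong (λ s → δ₂ - sgn (opposite s) * δ₁) (Sign.*-comm s₂ s₁) ⟩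
    δ₂ - sgn (σ B i) * δ₁
      ∎
    where
    open ≡-Reasoning
    s₁ s₂ : Sign
    s₁ = sg₁ B i
    s₂ = sg₂ B i
    δ₁ δ₂ : ℤ
    δ₁ = δ (vtx₁ B i) v
    δ₂ = δ (vtx₂ B i) v

  loop-step : ∀ {i v} w → vtx₁ B i ≡ v × vtx₂ B i ≡ v →
    dArrow B v i * IT B w i ≡ δ v w - sgn (σ B i) * δ v w
  loop-step {i} {v} w (u₁≡v , u₂≡v) with sg₁ B i Sign.≟ sg₂ B i
  ... | yes s₁≡s₂ = trans (cong₂ _*_ (dArrow-loop u₁≡v u₂≡v s₁≡s₂) (loop-column w u₁≡v u₂≡v))
    (sgn-cancel-loop s₁≡s₂ (δ v w))
  ... | no s₁≢s₂ = trans (cong₂ _*_ (dArrow-directed-loop directed) (loop-column w u₁≡v u₂≡v))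
    (sgn-cancel-directed-loop (≢⇒≡opposite s₁≢s₂) (+ 1) (δ v w))
    where
    directed : DirectedLoop B i v
    directed = u₁≡v , u₂≡v , ≢⇒≡opposite s₁≢s₂

  inverse-loop-step : ∀ {i v} w → DirectedLoop B i v → -[1+ 0 ] * IT B w i ≡ δ v w - sgn (σ B i) * δ v w
  inverse-loop-step {i} {v} w (u₁≡v , u₂≡v , s₂≡-s₁) =
    trans (cong (-[1+ 0 ] *_) (loop-column w u₁≡v u₂≡v)) (sgn-cancel-directed-loop s₂≡-s₁ -[1+ 0 ] (δ v w))

  step-column : ∀ {u w} (st : Step B u w) v →
    dStep B st * IT B v (stepArrow B st) ≡ δ u v - sgn (stepSign B st) * δ w v
  step-column {u} {w} (arr i u~w) v with u ≟ w
  ... | yes refl = loop-step v (reduce u~w)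
  step-column (arr i (inj₁ (refl , refl))) v | no u≢w = link-step₁ v u≢w
  step-column (arr i (inj₂ (refl , refl))) v | no w≢u = link-step₂ v (w≢u ∘ sym)
  step-column (inv i loop) v = inverse-loop-step v loop

  walkSign : ∀ {u w} → Walk B u w → Sign
  walkSign [] = Sign.+
  walkSign (st ∷ ω) = stepSign B st Sign.* walkSign ω

  ITmul-incAcc : ∀ {u w} s (ω : Walk B u w) v →
    ITmul B (incAcc B s ω) v ≡ sgn s * (δ u v - sgn (walkSign ω) * δ w v)
  ITmul-incAcc {u} s [] v = trans (·-zeroʳ (IT B v)) (vanish (sgn s) (δ u v))
    where
    vanish : ∀ c d → + 0 ≡ c * (d - + 1 * d)
    vanish = solve-∀
  ITmul-incAcc {u} s (_∷_ {w = w} {z} st ω) v = begin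
    ITmul B (incAcc B s (st ∷ ω)) v
      ≡⟨ ·-distribʳ-+ (IT B v) (λ j → k * e B i j) (incAcc B s′ ω) ⟩
    IT B v · (λ j → k * e B i j) + ITmul B (incAcc B s′ ω) v
      ≡⟨ cong₂ _+_ (trans (·-*ʳ (IT B v) k (e B i)) (cong (k *_) ITv·eᵢ)) (ITmul-incAcc s′ ω v) ⟩
    k * IT B v i + sgn s′ * (δ w v - sgn t * δ z v)
      ≡⟨ cong₂ (λ p r → p * dStep B st * IT B v i + r * (δ w v - sgn t * δ z v))
           (signℤ≡sgn s) (sgn-* s σ₁) ⟩
    sgn s * dStep B st * IT B v i + sgn s * sgn σ₁ * (δ w v - sgn t * δ z v)
      ≡⟨ cong (_+ sgn s * sgn σ₁ * (δ w v - sgn t * δ z v))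
           (trans (ℤ.*-assoc (sgn s) (dStep B st) (IT B v i)) (cong (sgn s *_) (step-column st v))) ⟩
    sgn s * (δ u v - sgn σ₁ * δ w v) + sgn s * sgn σ₁ * (δ w v - sgn t * δ z v)
      ≡⟨ telescope (sgn s) (sgn σ₁) (sgn t) (δ u v) (δ w v) (δ z v) ⟩
    sgn s * (δ u v - sgn σ₁ * sgn t * δ z v)
      ≡⟨ cong (λ r → sgn s * (δ u v - r * δ z v)) (sgn-* σ₁ t) ⟨
    sgn s * (δ u v - sgn (σ₁ Sign.* t) * δ z v) ∎
    where
    open ≡-Reasoning
    i : Fin n
    i = stepArrow B st
    σ₁ t s′ : Sign
    σ₁ = stepSign B st
    t = walkSign ω
    s′ = s Sign.* σ₁
    k : ℤ
    k = signℤ B s * dStep B st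
    ITv·eᵢ : IT B v · e B i ≡ IT B v i
    ITv·eᵢ = trans (·-congʳ (IT B v) (e≡δ i)) (·δ≡ (IT B v) i)
    telescope : ∀ c r t a b d → c * (a - r * b) + c * r * (b - t * d) ≡ c * (a - r * t * d)
    telescope = solve-∀

  ITmul-inc : ∀ {u w} (ω : Walk B u w) v → ITmul B (inc B ω) v ≡ δ u v - sgn (walkSign ω) * δ w v
  ITmul-inc {u} {w} ω v = trans (ITmul-incAcc Sign.+ ω v) (ℤ.*-identityˡ (δ u v - sgn (walkSign ω) * δ w v))

  ITmul-+ : ∀ (y x : Fin n → ℤ) v → ITmul B (λ i → y i + x i) v ≡ ITmul B y v + ITmul B x v
  ITmul-+ y x v = ·-distribʳ-+ (IT B v) y x

  q≡½*ITmul·ITmul : ∀ x → q B x ≡ ½ ℚ.* toℚ (ITmul B x · ITmul B x)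
  q≡½*ITmul·ITmul x = cong (λ z → ½ ℚ.* toℚ z) (·-adjoint (IT B) x (ITmul B x))

  qb≡ITmul·ITmul : ∀ y x → qb B y x ≡ toℚ (ITmul B y · ITmul B x)
  qb≡ITmul·ITmul y x = begin
    q B y+x ℚ.- q B y ℚ.- q B x
      ≡⟨ cong₂ (λ p r → p ℚ.- r ℚ.- q B x) (q≡½*ITmul·ITmul y+x) (q≡½*ITmul·ITmul y) ⟩
    ½ ℚ.* toℚ (ITmul B y+x · ITmul B y+x) ℚ.- ½ ℚ.* toℚ P ℚ.- q B x
      ≡⟨ cong₂ (λ p r → ½ ℚ.* toℚ p ℚ.- ½ ℚ.* toℚ P ℚ.- r)
           (trans (·-cong (ITmul-+ y x) (ITmul-+ y x)) (·-square-+ (ITmul B y) (ITmul B x))) (q≡½*ITmul·ITmul x) ⟩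
    ½ ℚ.* toℚ (P + + 2 * Q + R) ℚ.- ½ ℚ.* toℚ P ℚ.- ½ ℚ.* toℚ R
      ≡⟨ cong (λ t → ½ ℚ.* t ℚ.- ½ ℚ.* toℚ P ℚ.- ½ ℚ.* toℚ R) toℚ-expansion ⟩
    ½ ℚ.* (toℚ P ℚ.+ toℚ (+ 2) ℚ.* toℚ Q ℚ.+ toℚ R) ℚ.- ½ ℚ.* toℚ P ℚ.- ½ ℚ.* toℚ R
      ≡⟨ halving (toℚ P) (toℚ Q) (toℚ R) ⟩
    toℚ Q ∎
    where
    open ≡-Reasoning
    y+x : Fin n → ℤ
    y+x i = y i + x i
    P Q R : ℤ
    P = ITmul B y · ITmul B y
    Q = ITmul B y · ITmul B x
    R = ITmul B x · ITmul B x
    toℚ-expansion : toℚ (P + + 2 * Q + R) ≡ toℚ P ℚ.+ toℚ (+ 2) ℚ.* toℚ Q ℚ.+ toℚ R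
    toℚ-expansion = trans (toℚ-+ (P + + 2 * Q) R)
      (cong (ℚ._+ toℚ R) (trans (toℚ-+ P (+ 2 * Q)) (cong (toℚ P ℚ.+_) (toℚ-* (+ 2) Q))))
    halving : ∀ p r t → ½ ℚ.* (p ℚ.+ toℚ (+ 2) ℚ.* r ℚ.+ t) ℚ.- ½ ℚ.* p ℚ.- ½ ℚ.* t ≡ r
    halving = solve 3 (λ p r t → con ½ :* (p :+ con (toℚ (+ 2)) :* r :+ t) :- con ½ :* p :- con ½ :* t := r) refl
      where open +-*-Solver

  ITmul·ITmul≢0 : ∀ {x} → q B x ≢ 0ℚ → ITmul B x · ITmul B x ≢ + 0
  ITmul·ITmul≢0 {x} q≢0 norm≡0 = q≢0 (trans (q≡½*ITmul·ITmul x) (cong (λ z → ½ ℚ.* toℚ z) norm≡0))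

  inc-coroot : ∀ {x} → InRinc B x → q B x ≢ 0ℚ → IntegralCoroot (ITmul B x)
  inc-coroot {x} (u , w , ω , inj₁ x≗inc) q≢0 =
    signed-difference-coroot Sign.+ {u} {w} (walkSign ω) ITmul≗ (ITmul·ITmul≢0 q≢0)
    where
    ITmul≗ : ∀ v → ITmul B x v ≡ + 1 * (δ u v - sgn (walkSign ω) * δ w v)
    ITmul≗ v = trans (·-congʳ (IT B v) x≗inc) (trans (ITmul-inc ω v) (sym (ℤ.*-identityˡ _)))
  inc-coroot {x} (u , w , ω , inj₂ x≗-inc) q≢0 =
    signed-difference-coroot Sign.- {u} {w} (walkSign ω) ITmul≗ (ITmul·ITmul≢0 q≢0)
    where
    ITmul≗ : ∀ v → ITmul B x v ≡ -[1+ 0 ] * (δ u v - sgn (walkSign ω) * δ w v)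
    ITmul≗ v = trans (·-congʳ (IT B v) x≗-inc)
      (trans (·-negʳ (IT B v) (inc B ω)) (trans (cong -_ (ITmul-inc ω v)) (sym (ℤ.-1*i≡-i _))))

-- The reflection ρ_x

module Reflection {m n} (B : BidirectedGraph m n) (x : Fin n → ℤ)
                  (κ : IntegralCoroot (ITmul B x)) (q≢0 : q B x ≢ 0ℚ) where
  open IntegralCoroot κ

  pairing : (Fin n → ℤ) → ℤ
  pairing y = ITmul B y · coroot

  ρℤ : (Fin n → ℤ) → Fin n → ℤ
  ρℤ y j = y j - pairing y * x j

  qb≡0⇒q≡0 : qb B x x ≡ 0ℚ → q B x ≡ 0ℚ
  qb≡0⇒q≡0 qb≡0 = trans (q≡½*ITmul·ITmul B x) (cong (½ ℚ.*_) (trans (sym (qb≡ITmul·ITmul B x x)) qb≡0))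

  coef≡pairing : ∀ y → coef B x y ≡ toℚ (pairing y)
  coef≡pairing y with qb B x x ℚ.≟ 0ℚ
  ... | yes qb≡0 = ⊥-elim (q≢0 (qb≡0⇒q≡0 qb≡0))
  ... | no qb≢0 = p≡r*q⇒p÷q≡r _ _ _ {{ℚ.≢-nonZero qb≢0}} (begin
    toℚ (+ 2) ℚ.* qb B y x
      ≡⟨ cong (toℚ (+ 2) ℚ.*_) (trans (qb≡ITmul·ITmul B y x) (cong toℚ (·root≡scale*·coroot κ (ITmul B y)))) ⟩
    toℚ (+ 2) ℚ.* toℚ (scale * pairing y)        ≡⟨ toℚ-* (+ 2) (scale * pairing y) ⟨
    toℚ (+ 2 * (scale * pairing y))              ≡⟨ cong toℚ (rearrange scale (pairing y)) ⟩
    toℚ (pairing y * (scale * + 2))              ≡⟨ toℚ-* (pairing y) (scale * + 2) ⟩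
    toℚ (pairing y) ℚ.* toℚ (scale * + 2)
      ≡⟨ cong (toℚ (pairing y) ℚ.*_) (trans (qb≡ITmul·ITmul B x x) (cong toℚ (root·root≡scale*2 κ))) ⟨
    toℚ (pairing y) ℚ.* qb B x x                 ∎)
    where
    open ≡-Reasoning
    rearrange : ∀ g l → + 2 * (g * l) ≡ l * (g * + 2)
    rearrange = solve-∀

  toℚ∘ρℤ≡ρ : ∀ y j → toℚ (ρℤ y j) ≡ ρ B x y j
  toℚ∘ρℤ≡ρ y j = begin
    toℚ (y j - pairing y * x j)                  ≡⟨ toℚ-- (y j) (pairing y * x j) ⟩
    toℚ (y j) ℚ.- toℚ (pairing y * x j)          ≡⟨ cong (ℚ._-_ (toℚ (y j))) (toℚ-* (pairing y) (x j)) ⟩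
    toℚ (y j) ℚ.- toℚ (pairing y) ℚ.* toℚ (x j)  ≡⟨ cong (λ c → toℚ (y j) ℚ.- c ℚ.* toℚ (x j)) (coef≡pairing y) ⟨
    ρ B x y j                                    ∎
    where open ≡-Reasoning

  ITmul∘ρℤ≡reflect : ∀ y v → ITmul B (ρℤ y) v ≡ reflect κ (ITmul B y) v
  ITmul∘ρℤ≡reflect y v = ·-linearʳ (IT B v) y (pairing y) x

  pairing∘ρℤ : ∀ y → pairing (ρℤ y) ≡ - pairing y
  pairing∘ρℤ y = trans (·-cong (ITmul∘ρℤ≡reflect y) (λ _ → refl)) (reflect·coroot κ (ITmul B y))

  ρℤ-involutive : ∀ y j → ρℤ (ρℤ y) j ≡ y j
  ρℤ-involutive y j = trans (cong (λ c → ρℤ y j - c * x j) (pairing∘ρℤ y)) (undo (y j) (pairing y) (x j))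
    where
    undo : ∀ a l c → (a - l * c) - (- l) * c ≡ a
    undo = solve-∀

  IT∘ρ≡reflection∘ITmul : ∀ y v → sumℚ (λ i → toℚ (IT B v i) ℚ.* ρ B x y i) ≡ toℚ (reflection κ v · ITmul B y)
  IT∘ρ≡reflection∘ITmul y v = begin
    sumℚ (λ i → toℚ (IT B v i) ℚ.* ρ B x y i)
      ≡⟨ sumℚ-toℚ (λ i → IT B v i * ρℤ y i) entrywise ⟩
    toℚ (ITmul B (ρℤ y) v)
      ≡⟨ cong toℚ (trans (ITmul∘ρℤ≡reflect y v) (sym (reflection·≡reflect κ (ITmul B y) v))) ⟩
    toℚ (reflection κ v · ITmul B y)
      ∎
    where
    open ≡-Reasoning
    entrywise : ∀ i → toℚ (IT B v i) ℚ.* ρ B x y i ≡ toℚ (IT B v i * ρℤ y i)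
    entrywise i = trans (cong (toℚ (IT B v i) ℚ.*_) (sym (toℚ∘ρℤ≡ρ y i))) (sym (toℚ-* (IT B v i) (ρℤ y i)))

-- Connectedness is a standing assumption of the paper; this statement does not need it.
lemma7p9 : {m n : ℕ} (B : BidirectedGraph m n) → Connected B →
    (x : Fin n → ℤ) → InRinc B x → q B x ≢ 0ℚ →
    (Σ ((Fin n → ℤ) → (Fin n → ℤ)) λ R →
      (∀ y j → toℚ (R y j) ≡ ρ B x y j) ×
      (Σ ((Fin n → ℤ) → (Fin n → ℤ)) λ R' →
        (∀ y j → R (R' y) j ≡ y j) × (∀ y j → R' (R y) j ≡ y j)))
    × (Σ (Fin m → Fin m → ℤ) λ O → Orthogonal O ×
        (∀ (y : Fin n → ℤ) v →
          sumℚ (λ i → toℚ (IT B v i) Data.Rational.* ρ B x y i)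
            ≡ toℚ (sumℤ λ w → O v w Data.Integer.* ITmul B y w)))
lemma7p9 B _ x x∈𝓡 q≢0 =
  (ρℤ , toℚ∘ρℤ≡ρ , ρℤ , ρℤ-involutive , ρℤ-involutive) ,
  (reflection κ , reflection-orthogonal κ , IT∘ρ≡reflection∘ITmul)
  where
  κ : IntegralCoroot (ITmul B x)
  κ = inc-coroot B x∈𝓡 q≢0
  open Reflection B x κ q≢0
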